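{- Let $\psi$ be the real root of $x^3=x^2+x+1$. For all integers $n\ge0$, $$-0.596<[(n)_T\,0]_T-\psi n<0.856,$$ $$-0.883<[(n)_T\,00]_T-\psi^2 n<1.460,$$ $$-1.461<[(n)_T\,000]_T-\psi^3 n<2.298.$$
   Context: Tribonacci numbers: $T_{ -3}=T_{ -2}=0$, $T_{ -1}=1$, $T_n=T_{n-1}+T_{n-2}+T_{n-3}$ for $n\ge0$ (so $T_0=1,T_1=2,T_2=4,T_3=7$). For a finite binary string $E=e_1\cdots e_i$, $[E]_T=\sum_{1\le j\le i}e_jT_{i-j}$. For an integer $n\ge0$, $(n)_T$ is the canonical Tribonacci representation of $n$: the binary string obtained by the greedy algorithm (repeatedly subtracting the largest possible Tribonacci number), least significant digit on the right, equivalently the string $E$ with $[E]_T=n$ having no three consecutive $1$'s (unique up to leading zeros). $(n)_T\,0$, etc., denotes concatenation of binary strings. -}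

module Defs where

open import Data.Digit using (Bit; 0b; 1b)
open import Data.Fin.Base using (toℕ)
import Data.Fin.Properties as Fin
import Data.Integer.Base as ℤ
open import Data.List.Base using (List; []; _∷_; length; dropWhile)
open import Data.Nat.Base as ℕ using (ℕ; zero; suc)
import Data.Nat.Properties as ℕ
open import Data.Product.Base using (∃; ∃₂; _×_; _,_)
open import Data.Rational.Base as ℚ using (ℚ; 0ℚ; 1ℚ; ½; ∣_∣; 1/_)
import Data.Rational.Properties as ℚ
open import Data.Rational.Solver using (module +-*-Solver)
open import Relation.Binary.PropositionalEquality
  using (_≡_; refl; sym; trans; cong; cong₂; subst; module ≡-Reasoning)
open import Relation.Nullary.Decidable using (yes; no)

------------------------------------------------------------------------
-- Tribonacci numbers and representations

-- The index is shifted by three: tribonacci k is T_{k-3}.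
tribonacci : ℕ → ℕ
tribonacci 0 = 0
tribonacci 1 = 0
tribonacci 2 = 1
tribonacci (suc (suc (suc k))) =
  tribonacci (suc (suc k)) ℕ.+ tribonacci (suc k) ℕ.+ tribonacci k

T : ℕ → ℕ
T n = tribonacci (3 ℕ.+ n)

-- Binary strings are read with the least significant digit last.
[_]ₜ : List Bit → ℕ
[ [] ]ₜ    = 0
[ e ∷ E ]ₜ = toℕ e ℕ.* T (length E) ℕ.+ [ E ]ₜ

-- greedy k n runs the greedy algorithm on n with the numbers
-- T (k - 1), …, T 0, returning a string of length k.  For n < T k each
-- number is subtracted at most once, because T (i + 1) ≤ 2 T i.
greedy : ℕ → ℕ → List Bit
greedy zero    n = []
greedy (suc k) n with T k ℕ.≤? n
... | yes _ = 1b ∷ greedy k (n ℕ.∸ T k)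
... | no  _ = 0b ∷ greedy k n

-- Starting from position n suffices since n < T n; the leading zeros
-- this produces are removed, so that ⟨ 0 ⟩ₜ is the empty string.
⟨_⟩ₜ : ℕ → List Bit
⟨ n ⟩ₜ = dropWhile (Fin._≟ 0b) (greedy n n)

------------------------------------------------------------------------
-- Real numbers, as Cauchy sequences of rationals

IsCauchy : (ℕ → ℚ) → Set
IsCauchy x = ∀ ε → 0ℚ ℚ.< ε →
  ∃ λ N → ∀ m n → N ℕ.≤ m → N ℕ.≤ n → ∣ x m ℚ.- x n ∣ ℚ.< ε

record ℝ : Set where
  constructor mkℝ
  field
    seq    : ℕ → ℚ
    cauchy : IsCauchy seq

open ℝ public

infix 4 _≃_ _<_

_≃_ : ℝ → ℝ → Set
x ≃ y = ∀ ε → 0ℚ ℚ.< ε →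
  ∃ λ N → ∀ n → N ℕ.≤ n → ∣ seq x n ℚ.- seq y n ∣ ℚ.< ε

-- The gap ε is uniform: termwise inequality alone would allow x ≃ y.
_<_ : ℝ → ℝ → Set
x < y = ∃₂ λ ε N → 0ℚ ℚ.< ε × (∀ n → N ℕ.≤ n → seq x n ℚ.+ ε ℚ.< seq y n)

private

  const-cauchy : ∀ q → IsCauchy (λ _ → q)
  const-cauchy q ε 0<ε = 0 , λ _ _ _ _ →
    subst (ℚ._< ε) (sym (cong ∣_∣ (ℚ.+-inverseʳ q))) 0<ε

  neg-cauchy : ∀ {x} → IsCauchy x → IsCauchy (λ n → ℚ.- x n)
  neg-cauchy {x} cx ε 0<ε with cx ε 0<ε
  ... | N , close = N , λ m n N≤m N≤n →
    subst (ℚ._< ε) (sym (lemma (x m) (x n))) (close m n N≤m N≤n)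
    where
    lemma : ∀ p q → ∣ ℚ.- p ℚ.- ℚ.- q ∣ ≡ ∣ p ℚ.- q ∣
    lemma p q = trans (cong ∣_∣ (sym (ℚ.neg-distrib-+ p (ℚ.- q))))
                      (ℚ.∣-p∣≡∣p∣ (p ℚ.- q))

  ε/2 : ∀ {ε} → 0ℚ ℚ.< ε → 0ℚ ℚ.< ½ ℚ.* ε
  ε/2 {ε} 0<ε = ℚ.*-monoʳ-<-pos ½ 0<ε

  ½+½ : ∀ ε → ½ ℚ.* ε ℚ.+ ½ ℚ.* ε ≡ ε
  ½+½ ε = trans (sym (ℚ.*-distribʳ-+ ε ½ ½)) (ℚ.*-identityˡ ε)

  +-cauchy : ∀ {x y} → IsCauchy x → IsCauchy y →
             IsCauchy (λ n → x n ℚ.+ y n)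
  +-cauchy {x} {y} cx cy ε 0<ε
    with cx (½ ℚ.* ε) (ε/2 0<ε) | cy (½ ℚ.* ε) (ε/2 0<ε)
  ... | M , closeˣ | N , closeʸ = M ℕ.⊔ N , λ m n m≥ n≥ → begin-strict
    ∣ (x m ℚ.+ y m) ℚ.- (x n ℚ.+ y n) ∣
      ≡⟨ cong ∣_∣ (solve 4 (λ a b c d →
           (a :+ b) :- (c :+ d) := (a :- c) :+ (b :- d)) refl
           (x m) (y m) (x n) (y n)) ⟩
    ∣ (x m ℚ.- x n) ℚ.+ (y m ℚ.- y n) ∣
      ≤⟨ ℚ.∣p+q∣≤∣p∣+∣q∣ (x m ℚ.- x n) (y m ℚ.- y n) ⟩
    ∣ x m ℚ.- x n ∣ ℚ.+ ∣ y m ℚ.- y n ∣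
      <⟨ ℚ.+-mono-<
           (closeˣ m n (ℕ.m⊔n≤o⇒m≤o M N m≥) (ℕ.m⊔n≤o⇒m≤o M N n≥))
           (closeʸ m n (ℕ.m⊔n≤o⇒n≤o M N m≥) (ℕ.m⊔n≤o⇒n≤o M N n≥)) ⟩
    ½ ℚ.* ε ℚ.+ ½ ℚ.* ε
      ≡⟨ ½+½ ε ⟩
    ε ∎
    where
    open ℚ.≤-Reasoning
    open +-*-Solver

  bounded : ∀ {x} → IsCauchy x →
            ∃₂ λ B N → ℚ.Positive B × (∀ n → N ℕ.≤ n → ∣ x n ∣ ℚ.≤ B)
  bounded {x} cx with cx 1ℚ (ℚ.positive⁻¹ 1ℚ)
  ... | N , close = 1ℚ ℚ.+ ∣ x N ∣ , N
      , ℚ.pos+nonNeg⇒pos 1ℚ ∣ x N ∣ {{ℚ.∣-∣-nonNeg (x N)}}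
      , λ n N≤n → begin
    ∣ x n ∣
      ≡⟨ cong ∣_∣ (solve 2 (λ a b → a := (a :- b) :+ b) refl (x n) (x N)) ⟩
    ∣ (x n ℚ.- x N) ℚ.+ x N ∣
      ≤⟨ ℚ.∣p+q∣≤∣p∣+∣q∣ (x n ℚ.- x N) (x N) ⟩
    ∣ x n ℚ.- x N ∣ ℚ.+ ∣ x N ∣
      ≤⟨ ℚ.+-monoˡ-≤ ∣ x N ∣ (ℚ.<⇒≤ (close n N N≤n ℕ.≤-refl)) ⟩
    1ℚ ℚ.+ ∣ x N ∣ ∎
    where
    open ℚ.≤-Reasoning
    open +-*-Solver

  split : ∀ A B ε → ℚ.Positive A → ℚ.Positive B → 0ℚ ℚ.< ε →
          ∃ λ δ → 0ℚ ℚ.< δ × A ℚ.* δ ℚ.+ B ℚ.* δ ≡ ε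
  split A B ε A>0 B>0 0<ε = c ℚ.* ε , 0<cε , (begin
    A ℚ.* (c ℚ.* ε) ℚ.+ B ℚ.* (c ℚ.* ε)
      ≡⟨ ℚ.*-distribʳ-+ (c ℚ.* ε) A B ⟨
    (A ℚ.+ B) ℚ.* (c ℚ.* ε)
      ≡⟨ ℚ.*-assoc (A ℚ.+ B) c ε ⟨
    (A ℚ.+ B) ℚ.* c ℚ.* ε
      ≡⟨ cong (ℚ._* ε) (ℚ.*-inverseʳ (A ℚ.+ B)) ⟩
    1ℚ ℚ.* ε
      ≡⟨ ℚ.*-identityˡ ε ⟩
    ε ∎)
    where
    open ≡-Reasoning
    instance
      A+B>0 : ℚ.Positive (A ℚ.+ B)
      A+B>0 = ℚ.pos+pos⇒pos A {{A>0}} B {{B>0}}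
      A+B≢0 : ℚ.NonZero (A ℚ.+ B)
      A+B≢0 = ℚ.pos⇒nonZero (A ℚ.+ B)
    c = 1/ (A ℚ.+ B)
    0<cε : 0ℚ ℚ.< c ℚ.* ε
    0<cε = ℚ.positive⁻¹ (c ℚ.* ε)
      {{ℚ.pos*pos⇒pos c {{ℚ.1/pos⇒pos (A ℚ.+ B)}} ε {{ℚ.positive 0<ε}}}}

  diff : ∀ a b c d → a ℚ.* b ℚ.- c ℚ.* d ≡ a ℚ.* (b ℚ.- d) ℚ.+ d ℚ.* (a ℚ.- c)
  diff = solve 4 (λ a b c d →
    a :* b :- c :* d := a :* (b :- d) :+ d :* (a :- c)) refl
    where open +-*-Solver

  *-close : ∀ {A B δ ε} → ℚ.Positive A → ℚ.Positive B → A ℚ.* δ ℚ.+ B ℚ.* δ ≡ ε →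
            ∀ a b c d → ∣ a ∣ ℚ.≤ A → ∣ d ∣ ℚ.≤ B →
            ∣ a ℚ.- c ∣ ℚ.< δ → ∣ b ℚ.- d ∣ ℚ.< δ →
            ∣ a ℚ.* b ℚ.- c ℚ.* d ∣ ℚ.< ε
  *-close {A} {B} {δ} {ε} A>0 B>0 Aδ+Bδ≡ε a b c d a≤A d≤B a-c<δ b-d<δ =
    begin-strict
    ∣ a ℚ.* b ℚ.- c ℚ.* d ∣
      ≡⟨ cong ∣_∣ (diff a b c d) ⟩
    ∣ a ℚ.* (b ℚ.- d) ℚ.+ d ℚ.* (a ℚ.- c) ∣
      ≤⟨ ℚ.∣p+q∣≤∣p∣+∣q∣ (a ℚ.* (b ℚ.- d)) (d ℚ.* (a ℚ.- c)) ⟩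
    ∣ a ℚ.* (b ℚ.- d) ∣ ℚ.+ ∣ d ℚ.* (a ℚ.- c) ∣
      ≡⟨ cong₂ ℚ._+_ (ℚ.∣p*q∣≡∣p∣*∣q∣ a (b ℚ.- d))
                     (ℚ.∣p*q∣≡∣p∣*∣q∣ d (a ℚ.- c)) ⟩
    ∣ a ∣ ℚ.* ∣ b ℚ.- d ∣ ℚ.+ ∣ d ∣ ℚ.* ∣ a ℚ.- c ∣
      ≤⟨ ℚ.+-mono-≤
           (ℚ.*-monoʳ-≤-nonNeg ∣ b ℚ.- d ∣ {{ℚ.∣-∣-nonNeg (b ℚ.- d)}} a≤A)
           (ℚ.*-monoʳ-≤-nonNeg ∣ a ℚ.- c ∣ {{ℚ.∣-∣-nonNeg (a ℚ.- c)}} d≤B) ⟩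
    A ℚ.* ∣ b ℚ.- d ∣ ℚ.+ B ℚ.* ∣ a ℚ.- c ∣
      <⟨ ℚ.+-mono-< (ℚ.*-monoʳ-<-pos A {{A>0}} b-d<δ)
                    (ℚ.*-monoʳ-<-pos B {{B>0}} a-c<δ) ⟩
    A ℚ.* δ ℚ.+ B ℚ.* δ
      ≡⟨ Aδ+Bδ≡ε ⟩
    ε ∎
    where open ℚ.≤-Reasoning

  *-cauchy : ∀ {x y} → IsCauchy x → IsCauchy y →
             IsCauchy (λ n → x n ℚ.* y n)
  *-cauchy {x} {y} cx cy ε 0<ε =
    let A , K , A>0 , x≤A = bounded {x} cx
        B , L , B>0 , y≤B = bounded {y} cy
        δ , 0<δ , Aδ+Bδ≡ε = split A B ε A>0 B>0 0<ε
        M , closeˣ        = cx δ 0<δ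
        N , closeʸ        = cy δ 0<δ
    in (K ℕ.⊔ L) ℕ.⊔ (M ℕ.⊔ N) , λ m n m≥ n≥ →
    let KL≤m = ℕ.m⊔n≤o⇒m≤o (K ℕ.⊔ L) (M ℕ.⊔ N) m≥
        KL≤n = ℕ.m⊔n≤o⇒m≤o (K ℕ.⊔ L) (M ℕ.⊔ N) n≥
        MN≤m = ℕ.m⊔n≤o⇒n≤o (K ℕ.⊔ L) (M ℕ.⊔ N) m≥
        MN≤n = ℕ.m⊔n≤o⇒n≤o (K ℕ.⊔ L) (M ℕ.⊔ N) n≥
    in *-close A>0 B>0 Aδ+Bδ≡ε (x m) (y m) (x n) (y n)
         (x≤A m (ℕ.m⊔n≤o⇒m≤o K L KL≤m))
         (y≤B n (ℕ.m⊔n≤o⇒n≤o K L KL≤n))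
         (closeˣ m n (ℕ.m⊔n≤o⇒m≤o M N MN≤m) (ℕ.m⊔n≤o⇒m≤o M N MN≤n))
         (closeʸ m n (ℕ.m⊔n≤o⇒n≤o M N MN≤m) (ℕ.m⊔n≤o⇒n≤o M N MN≤n))

infixl 6 _+_ _-_
infixl 7 _*_
infixr 8 _^_
infix  8 -_

fromℚ : ℚ → ℝ
fromℚ q = mkℝ (λ _ → q) (const-cauchy q)

fromℕ : ℕ → ℝ
fromℕ n = fromℚ (ℤ.+ n ℚ./ 1)

1ℝ : ℝ
1ℝ = fromℚ 1ℚ

-_ : ℝ → ℝ
- x = mkℝ (λ n → ℚ.- seq x n) (neg-cauchy {seq x} (cauchy x))

_+_ : ℝ → ℝ → ℝ
x + y = mkℝ (λ n → seq x n ℚ.+ seq y n) (+-cauchy {seq x} {seq y} (cauchy x) (cauchy y))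

_-_ : ℝ → ℝ → ℝ
x - y = x + (- y)

_*_ : ℝ → ℝ → ℝ
x * y = mkℝ (λ n → seq x n ℚ.* seq y n) (*-cauchy {seq x} {seq y} (cauchy x) (cauchy y))

_^_ : ℝ → ℕ → ℝ
x ^ zero  = 1ℝ
x ^ suc n = x * x ^ n

module Submission where

-- Fix k and let δ j = T (k + j) - ψ ^ k * T j.  If E is a binary string with
-- [ E ]ₜ = n, then [ E 0^k ]ₜ - ψ ^ k * n is the sum of the δ j over the
-- positions j of the ones of E.  It therefore lies between the sum of the
-- negative parts and the sum of the positive parts of all the δ j, and these
-- two sums already lie within the stated bounds.  Nothing is needed about the
-- canonical representation except that its value is n (value-⟨_⟩).
--
-- The two sums are estimated as follows.  The terms with j < 40 are computed
-- with ψ enclosed in an interval of length 10 ^ -16 (δ≤excess, -δ≤deficit).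
-- The remaining ones decay geometrically.  For k = 1 the sequence δ is
-- d j = T (j + 1) - ψ * T j, which involves only the two roots of
-- x ^ 3 = x ^ 2 + x + 1 inside the unit disc, so that
--   d (j + 4) = (4 - 2 ψ) * d (j + 1) + (3 + 2 ψ - 2 ψ ^ 2) * d j.
-- Here the absolute values of the coefficients are at most 7/20 and 1/10, and
-- 7/20 * 4/5 + 1/10 < (4/5) ^ 4 gives a decay by the factor 4/5 at each step
-- (d-decay).  The case of general k follows by induction on k (δ-decay).
--
-- Since ψ is a Cauchy sequence of rationals, all of this is carried out for a
-- rational q in place of ψ.  Each identity then has an error term that is
-- proportional to residual q = q ^ 3 - (q ^ 2 + q + 1) and to T j; summed over
-- the digits of E, the errors make up a multiple of residual q * n
-- (deviation-bounds).  As n is fixed and the residual tends to zero along ψ,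
-- the error is eventually below the margin left in the bounds.

open import Data.Digit using (Bit; 0b)
open import Data.Integer.Base using (+_)
open import Data.List.Base using (List; []; _∷_; _++_; length; replicate; dropWhile)
open import Data.Nat.Base as ℕ using (ℕ; zero; suc)
open import Data.Product.Base using (∃; _×_; _,_; proj₁; proj₂)
open import Data.Rational.Base using (ℚ; 0ℚ; 1ℚ; _/_)
open import Relation.Binary.PropositionalEquality
open import Data.Unit.Base using (tt)

-- Estimates for a rational approximation of ψ
module Rational where

  import Data.Fin.Base as Fin
  import Data.Fin.Properties as Fin
  import Data.Integer.Base as ℤ
  import Data.Integer.Properties as ℤ
  import Data.List.Properties as List
  import Data.Nat.Properties as ℕ
  open import Data.Rational.Base hiding (_/_; ℚ; 0ℚ; 1ℚ)
  open import Data.Rational.Properties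
  open import Data.Rational.Unnormalised.Base as ℚᵘ using (mkℚᵘ; *≡*)
  import Data.Rational.Unnormalised.Properties as ℚᵘ
  open import Data.Rational.Solver using (module +-*-Solver)
  open +-*-Solver using (solve; _:+_; _:*_; _:-_; :-_; _:=_; con)
  open import Data.Sum.Base using (inj₁; inj₂)
  open import Relation.Nullary.Decidable using (yes; no; toWitness)
  open import Defs using (tribonacci; T; [_]ₜ; greedy; ⟨_⟩ₜ)

  -- Rational arithmetic

  infixr 8 _^_

  _^_ : ℚ → ℕ → ℚ
  q ^ zero  = 1ℚ
  q ^ suc n = q * q ^ n

  -- The embedding of the naturals, definitionally the one used in fromℕ.
  ι : ℕ → ℚ
  ι n = + n / 1

  fromℚᵘ-homo-+ : ∀ p q → fromℚᵘ p + fromℚᵘ q ≡ fromℚᵘ (p ℚᵘ.+ q)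
  fromℚᵘ-homo-+ p q = toℚᵘ-injective
    (ℚᵘ.≃-trans (toℚᵘ-homo-+ (fromℚᵘ p) (fromℚᵘ q))
    (ℚᵘ.≃-trans (ℚᵘ.+-cong (toℚᵘ-fromℚᵘ p) (toℚᵘ-fromℚᵘ q))
    (ℚᵘ.≃-sym (toℚᵘ-fromℚᵘ (p ℚᵘ.+ q)))))

  fromℚᵘ-homo-* : ∀ p q → fromℚᵘ p * fromℚᵘ q ≡ fromℚᵘ (p ℚᵘ.* q)
  fromℚᵘ-homo-* p q = toℚᵘ-injective
    (ℚᵘ.≃-trans (toℚᵘ-homo-* (fromℚᵘ p) (fromℚᵘ q))
    (ℚᵘ.≃-trans (ℚᵘ.*-cong (toℚᵘ-fromℚᵘ p) (toℚᵘ-fromℚᵘ q))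
    (ℚᵘ.≃-sym (toℚᵘ-fromℚᵘ (p ℚᵘ.* q)))))

  ι-+ : ∀ m n → ι (m ℕ.+ n) ≡ ι m + ι n
  ι-+ m n = sym (trans (fromℚᵘ-homo-+ (mkℚᵘ (+ m) 0) (mkℚᵘ (+ n) 0))
    (fromℚᵘ-cong {mkℚᵘ (+ m) 0 ℚᵘ.+ mkℚᵘ (+ n) 0} {mkℚᵘ (+ (m ℕ.+ n)) 0}
      (*≡* (cong (ℤ._* + 1) (cong₂ ℤ._+_ (ℤ.*-identityʳ (+ m)) (ℤ.*-identityʳ (+ n)))))))

  ι-* : ∀ m n → ι (m ℕ.* n) ≡ ι m * ι n
  ι-* m n = sym (trans (fromℚᵘ-homo-* (mkℚᵘ (+ m) 0) (mkℚᵘ (+ n) 0))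
    (fromℚᵘ-cong {mkℚᵘ (+ m) 0 ℚᵘ.* mkℚᵘ (+ n) 0} {mkℚᵘ (+ (m ℕ.* n)) 0}
      (*≡* (cong (ℤ._* + 1) (sym (ℤ.pos-* m n))))))

  ι-^ : ∀ m k → ι (m ℕ.^ k) ≡ ι m ^ k
  ι-^ m zero    = refl
  ι-^ m (suc k) = trans (ι-* m (m ℕ.^ k)) (cong (ι m *_) (ι-^ m k))

  ι≥0 : ∀ n → 0ℚ ≤ ι n
  ι≥0 n = nonNegative⁻¹ (ι n) {{normalize-nonNeg n 1}}

  +-nonneg : ∀ {p q} → 0ℚ ≤ p → 0ℚ ≤ q → 0ℚ ≤ p + q
  +-nonneg = +-mono-≤

  *-nonneg : ∀ {p q} → 0ℚ ≤ p → 0ℚ ≤ q → 0ℚ ≤ p * q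
  *-nonneg {p} {q} 0≤p 0≤q = nonNegative⁻¹ (p * q)
    {{nonNeg*nonNeg⇒nonNeg p {{nonNegative 0≤p}} q {{nonNegative 0≤q}}}}

  *-mono-≤ : ∀ {p q r s} → 0ℚ ≤ p → 0ℚ ≤ s → p ≤ q → r ≤ s → p * r ≤ q * s
  *-mono-≤ {p} {q} {r} {s} 0≤p 0≤s p≤q r≤s = ≤-trans
    (*-monoˡ-≤-nonNeg p {{nonNegative 0≤p}} r≤s)
    (*-monoʳ-≤-nonNeg s {{nonNegative 0≤s}} p≤q)

  *-monoʳ : ∀ {p q r} → 0ℚ ≤ p → q ≤ r → p * q ≤ p * r
  *-monoʳ {p} 0≤p = *-monoˡ-≤-nonNeg p {{nonNegative 0≤p}}

  *-monoˡ : ∀ {p q r} → 0ℚ ≤ p → q ≤ r → q * p ≤ r * p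
  *-monoˡ {p} 0≤p = *-monoʳ-≤-nonNeg p {{nonNegative 0≤p}}

  -- An inequality follows from exhibiting its slack r, usually by the ring solver.
  ≤-by : ∀ {p q r} → q ≡ p + r → 0ℚ ≤ r → p ≤ q
  ≤-by {p} {q} {r} q≡p+r 0≤r = begin
    p       ≡⟨ +-identityʳ p ⟨
    p + 0ℚ  ≤⟨ +-monoʳ-≤ p 0≤r ⟩
    p + r   ≡⟨ q≡p+r ⟨
    q       ∎
    where open ≤-Reasoning

  p≤q⇒0≤q-p : ∀ {p q} → p ≤ q → 0ℚ ≤ q - p
  p≤q⇒0≤q-p {p} {q} p≤q = subst (_≤ q - p) (+-inverseʳ p) (+-monoˡ-≤ (- p) p≤q)

  ι-mono-≤ : ∀ {m n} → m ℕ.≤ n → ι m ≤ ι n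
  ι-mono-≤ {m} {n} m≤n = ≤-by
    (trans (cong ι (sym (ℕ.m+[n∸m]≡n m≤n))) (ι-+ m (n ℕ.∸ m))) (ι≥0 (n ℕ.∸ m))

  -- Truncated subtraction computes the positive part.
  ι-∸ : ∀ m n → ι m - ι n ≤ ι (m ℕ.∸ n)
  ι-∸ m n = begin
    ι m - ι n                       ≤⟨ +-monoˡ-≤ (- ι n) (ι-mono-≤ (ℕ.m≤n+m∸n m n)) ⟩
    ι (n ℕ.+ (m ℕ.∸ n)) - ι n       ≡⟨ cong (_- ι n) (ι-+ n (m ℕ.∸ n)) ⟩
    ι n + ι (m ℕ.∸ n) - ι n         ≡⟨ solve 2 (λ x y → x :+ y :- x := y) refl (ι n) (ι (m ℕ.∸ n)) ⟩
    ι (m ℕ.∸ n)                     ∎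
    where
    open ≤-Reasoning

  ^-nonneg : ∀ {q} → 0ℚ ≤ q → ∀ k → 0ℚ ≤ q ^ k
  ^-nonneg 0≤q zero    = ≤ᵇ⇒≤ tt
  ^-nonneg 0≤q (suc k) = *-nonneg 0≤q (^-nonneg 0≤q k)

  ^-mono-≤ : ∀ {p q} → 0ℚ ≤ p → p ≤ q → ∀ k → p ^ k ≤ q ^ k
  ^-mono-≤ 0≤p p≤q zero    = ≤-refl
  ^-mono-≤ 0≤p p≤q (suc k) =
    *-mono-≤ 0≤p (^-nonneg (≤-trans 0≤p p≤q) k) p≤q (^-mono-≤ 0≤p p≤q k)

  ^-distrib-* : ∀ p q k → (p * q) ^ k ≡ p ^ k * q ^ k
  ^-distrib-* p q zero    = refl
  ^-distrib-* p q (suc k) = begin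
    p * q * (p * q) ^ k        ≡⟨ cong ((p * q) *_) (^-distrib-* p q k) ⟩
    p * q * (p ^ k * q ^ k)    ≡⟨ solve 4 (λ a b c d → a :* b :* (c :* d) := a :* c :* (b :* d))
                                    refl p q (p ^ k) (q ^ k) ⟩
    p * p ^ k * (q * q ^ k)    ∎
    where
    open ≡-Reasoning

  1^k≡1 : ∀ k → 1ℚ ^ k ≡ 1ℚ
  1^k≡1 zero    = refl
  1^k≡1 (suc k) = trans (*-identityˡ (1ℚ ^ k)) (1^k≡1 k)

  ∣∣≤ : ∀ {p q} → p ≤ q → - p ≤ q → ∣ p ∣ ≤ q
  ∣∣≤ {p} p≤q -p≤q with ∣p∣≡p∨∣p∣≡-p p
  ... | inj₁ eq = subst (_≤ _) (sym eq) p≤q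
  ... | inj₂ eq = subst (_≤ _) (sym eq) -p≤q

  p≤∣p∣ : ∀ p → p ≤ ∣ p ∣
  p≤∣p∣ p with ≤-total 0ℚ p
  ... | inj₁ 0≤p = ≤-reflexive (sym (0≤p⇒∣p∣≡p 0≤p))
  ... | inj₂ p≤0 = ≤-trans p≤0 (0≤∣p∣ p)

  ∣∣*-mono : ∀ {p q r s} → ∣ p ∣ ≤ q → ∣ r ∣ ≤ s → ∣ p * r ∣ ≤ q * s
  ∣∣*-mono {p} {q} {r} {s} p≤q r≤s = subst (_≤ q * s) (sym (∣p*q∣≡∣p∣*∣q∣ p r))
    (*-mono-≤ (0≤∣p∣ p) (≤-trans (0≤∣p∣ r) r≤s) p≤q r≤s)

  ∣∣+-mono : ∀ {p q r s} → ∣ p ∣ ≤ q → ∣ r ∣ ≤ s → ∣ p + r ∣ ≤ q + s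
  ∣∣+-mono {p} {q} {r} {s} p≤q r≤s = ≤-trans (∣p+q∣≤∣p∣+∣q∣ p r) (+-mono-≤ p≤q r≤s)

  -- Tribonacci numbers and greedy representations

  0<T : ∀ n → 0 ℕ.< tribonacci (2 ℕ.+ n)
  0<T zero    = ℕ.≤-refl
  0<T (suc n) = ℕ.≤-trans (0<T n)
    (ℕ.≤-trans (ℕ.m≤m+n _ (tribonacci (suc n))) (ℕ.m≤m+n _ (tribonacci n)))

  -- Hence greedy never has to subtract the same number twice.
  T-suc≤2*T : ∀ n → T (suc n) ℕ.≤ T n ℕ.+ T n
  T-suc≤2*T n = begin
    x ℕ.+ y ℕ.+ z       ≡⟨ ℕ.+-assoc x y z ⟩
    x ℕ.+ (y ℕ.+ z)     ≤⟨ ℕ.+-monoʳ-≤ x (ℕ.m≤m+n (y ℕ.+ z) (tribonacci n)) ⟩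
    x ℕ.+ x             ∎
    where
    open ℕ.≤-Reasoning
    x = tribonacci (3 ℕ.+ n)
    y = tribonacci (2 ℕ.+ n)
    z = tribonacci (1 ℕ.+ n)

  n<T : ∀ n → n ℕ.< T n
  n<T zero    = ℕ.≤-refl
  n<T (suc n) = begin-strict
    suc n                  ≤⟨ n<T n ⟩
    T n                    <⟨ ℕ.m<m+n (T n) (0<T n) ⟩
    T n ℕ.+ tribonacci (2 ℕ.+ n)  ≤⟨ ℕ.m≤m+n _ (tribonacci (1 ℕ.+ n)) ⟩
    T (suc n)              ∎
    where open ℕ.≤-Reasoning

  value-greedy : ∀ k {n} → n ℕ.< T k → length (greedy k n) ≡ k × [ greedy k n ]ₜ ≡ n
  value-greedy zero    {zero}  n<Tk = refl , refl
  value-greedy zero    {suc n} (ℕ.s≤s ())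
  value-greedy (suc k) {n}     n<Tk with T k ℕ.≤? n
  ... | no  Tk≰n =
    let len , val = value-greedy k (ℕ.≰⇒> Tk≰n) in cong suc len , val
  ... | yes Tk≤n =
    let len , val = value-greedy k (ℕ.+-cancelˡ-< (T k) _ _ (begin-strict
          T k ℕ.+ (n ℕ.∸ T k)  ≡⟨ ℕ.m+[n∸m]≡n Tk≤n ⟩
          n                    <⟨ n<Tk ⟩
          T (suc k)            ≤⟨ T-suc≤2*T k ⟩
          T k ℕ.+ T k          ∎))
    in cong suc len
     , trans (cong₂ ℕ._+_ (trans (ℕ.*-identityˡ _) (cong T len)) val) (ℕ.m+[n∸m]≡n Tk≤n)
    where open ℕ.≤-Reasoning

  value-dropWhile-0 : ∀ E → [ dropWhile (Fin._≟ 0b) E ]ₜ ≡ [ E ]ₜ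
  value-dropWhile-0 []                 = refl
  value-dropWhile-0 (Fin.zero ∷ E)     = value-dropWhile-0 E
  value-dropWhile-0 (Fin.suc e ∷ E)    = refl

  value-⟨_⟩ : ∀ n → [ ⟨ n ⟩ₜ ]ₜ ≡ n
  value-⟨ n ⟩ = trans (value-dropWhile-0 (greedy n n)) (proj₂ (value-greedy n (n<T n)))

  -- Weighted digit sums

  -- The Tribonacci numbers as rationals.
  t : ℕ → ℚ
  t j = ι (T j)

  -- The sum of the weights c j over the positions j of the ones of E, where
  -- positions are counted from the last digit.
  ⟦_⟧ : List Bit → (ℕ → ℚ) → ℚ
  ⟦ []    ⟧ c = 0ℚ
  ⟦ e ∷ E ⟧ c = ι (Fin.toℕ e) * c (length E) + ⟦ E ⟧ c

  value-zeros : ∀ k → [ replicate k 0b ]ₜ ≡ 0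
  value-zeros zero    = refl
  value-zeros (suc k) = value-zeros k

  value-shift : ∀ k E → ι [ E ++ replicate k 0b ]ₜ ≡ ⟦ E ⟧ (λ j → t (k ℕ.+ j))
  value-shift k []      = cong ι (value-zeros k)
  value-shift k (e ∷ E) = begin
    ι (Fin.toℕ e ℕ.* T (length E0) ℕ.+ [ E0 ]ₜ)    ≡⟨ ι-+ (Fin.toℕ e ℕ.* T (length E0)) [ E0 ]ₜ ⟩
    ι (Fin.toℕ e ℕ.* T (length E0)) + ι [ E0 ]ₜ    ≡⟨ cong₂ _+_ (ι-* (Fin.toℕ e) _) (value-shift k E) ⟩
    ι (Fin.toℕ e) * t (length E0) + ⟦ E ⟧ _        ≡⟨ cong (λ i → ι (Fin.toℕ e) * t i + ⟦ E ⟧ _) len ⟩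
    ι (Fin.toℕ e) * t (k ℕ.+ length E) + ⟦ E ⟧ _   ∎
    where
    open ≡-Reasoning
    E0 = E ++ replicate k 0b
    len : length E0 ≡ k ℕ.+ length E
    len = trans (List.length-++ E) (trans (cong (length E ℕ.+_) (List.length-replicate k))
            (ℕ.+-comm (length E) k))

  value : ∀ E → ι [ E ]ₜ ≡ ⟦ E ⟧ t
  value E = trans (cong (λ E → ι [ E ]ₜ) (sym (List.++-identityʳ E))) (value-shift 0 E)

  ⟦⟧-linear : ∀ E c x c′ → ⟦ E ⟧ (λ j → c j - x * c′ j) ≡ ⟦ E ⟧ c - x * ⟦ E ⟧ c′
  ⟦⟧-linear []      c x c′ = solve 1 (λ x → con 0ℚ := con 0ℚ :- x :* con 0ℚ) refl x
  ⟦⟧-linear (e ∷ E) c x c′ = trans (cong (λ s → b * (c ℓ - x * c′ ℓ) + s) (⟦⟧-linear E c x c′))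
    (solve 6 (λ b x y y′ z z′ →
      b :* (y :- x :* y′) :+ (z :- x :* z′) := b :* y :+ z :- x :* (b :* y′ :+ z′))
      refl b x (c ℓ) (c′ ℓ) (⟦ E ⟧ c) (⟦ E ⟧ c′))
    where
    ℓ = length E
    b = ι (Fin.toℕ e)

  ⟦⟧-neg : ∀ E c → ⟦ E ⟧ (λ j → - c j) ≡ - ⟦ E ⟧ c
  ⟦⟧-neg []      c = refl
  ⟦⟧-neg (e ∷ E) c = trans (cong (λ s → b * - c ℓ + s) (⟦⟧-neg E c))
    (solve 3 (λ b y z → b :* :- y :+ :- z := :- (b :* y :+ z)) refl b (c ℓ) (⟦ E ⟧ c))
    where
    ℓ = length E
    b = ι (Fin.toℕ e)

  -- The sum of f j over j < n.
  ∑ : ℕ → (ℕ → ℚ) → ℚ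
  ∑ zero    f = 0ℚ
  ∑ (suc n) f = ∑ n f + f n

  ∑-mono-≤ : ∀ n {f g} → (∀ j → f j ≤ g j) → ∑ n f ≤ ∑ n g
  ∑-mono-≤ zero    f≤g = ≤-refl
  ∑-mono-≤ (suc n) f≤g = +-mono-≤ (∑-mono-≤ n f≤g) (f≤g n)

  ∑-nonneg : ∀ n {f} → (∀ j → 0ℚ ≤ f j) → 0ℚ ≤ ∑ n f
  ∑-nonneg zero    0≤f = ≤-refl
  ∑-nonneg (suc n) 0≤f = +-nonneg (∑-nonneg n 0≤f) (0≤f n)

  ∑-split : ∀ m n f → ∑ (n ℕ.+ m) f ≡ ∑ m f + ∑ n (λ j → f (j ℕ.+ m))
  ∑-split m zero    f = sym (+-identityʳ (∑ m f))
  ∑-split m (suc n) f = trans (cong (_+ f (n ℕ.+ m)) (∑-split m n f)) (+-assoc (∑ m f) _ _)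

  -- The same sum for natural numbers, which evaluates much faster.
  ∑⁺ : ℕ → (ℕ → ℕ) → ℕ
  ∑⁺ zero    g = 0
  ∑⁺ (suc n) g = ∑⁺ n g ℕ.+ g n

  ∑-ι : ∀ n h g → ∑ n (λ j → h * ι (g j)) ≡ h * ι (∑⁺ n g)
  ∑-ι zero    h g = sym (*-zeroʳ h)
  ∑-ι (suc n) h g = begin
    ∑ n (λ j → h * ι (g j)) + h * ι (g n)  ≡⟨ cong (_+ (h * ι (g n))) (∑-ι n h g) ⟩
    h * ι (∑⁺ n g) + h * ι (g n)           ≡⟨ *-distribˡ-+ h _ _ ⟨
    h * (ι (∑⁺ n g) + ι (g n))             ≡⟨ cong (h *_) (ι-+ (∑⁺ n g) (g n)) ⟨
    h * ι (∑⁺ n g ℕ.+ g n)                 ∎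
    where open ≡-Reasoning

  -- Choosing the digits freely, one does best by taking the positive weights.
  ⟦⟧≤∑ : ∀ E x → ⟦ E ⟧ x ≤ ∑ (length E) (λ j → x j ⊔ 0ℚ)
  ⟦⟧≤∑ []      x = ≤-refl
  ⟦⟧≤∑ (e ∷ E) x = begin
    ι (Fin.toℕ e) * x ℓ + ⟦ E ⟧ x   ≤⟨ +-mono-≤ (digit e) (⟦⟧≤∑ E x) ⟩
    (x ℓ ⊔ 0ℚ) + ∑ ℓ _              ≡⟨ +-comm (x ℓ ⊔ 0ℚ) _ ⟩
    ∑ ℓ _ + (x ℓ ⊔ 0ℚ)              ∎
    where
    open ≤-Reasoning
    ℓ = length E
    digit : ∀ e → ι (Fin.toℕ e) * x ℓ ≤ x ℓ ⊔ 0ℚ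
    digit Fin.zero           = subst (_≤ x ℓ ⊔ 0ℚ) (sym (*-zeroˡ (x ℓ))) (p≤q⊔p (x ℓ) 0ℚ)
    digit (Fin.suc Fin.zero) = subst (_≤ x ℓ ⊔ 0ℚ) (sym (*-identityˡ (x ℓ))) (p≤p⊔q (x ℓ) 0ℚ)

  -- Geometric majorants

  -- w j = 3/5 * (4/5) ^ j; the factor 3/5 makes the first four cases of
  -- d-decay true.
  w : ℕ → ℚ
  w zero    = + 3 / 5
  w (suc j) = + 4 / 5 * w j

  w≥0 : ∀ j → 0ℚ ≤ w j
  w≥0 zero    = ≤ᵇ⇒≤ tt
  w≥0 (suc j) = *-nonneg {+ 4 / 5} (≤ᵇ⇒≤ tt) (w≥0 j)

  5ℚ : ℚ
  5ℚ = + 5 / 1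

  -- Telescoping, as w j = 5 * w j - 5 * w (suc j).
  ∑w≤ : ∀ m n → ∑ n (λ j → w (j ℕ.+ m)) ≤ 5ℚ * w m
  ∑w≤ m n = ≤-by (sym (telescope n)) (*-nonneg {5ℚ} (≤ᵇ⇒≤ tt) (w≥0 (n ℕ.+ m)))
    where
    telescope : ∀ n → ∑ n (λ j → w (j ℕ.+ m)) + 5ℚ * w (n ℕ.+ m) ≡ 5ℚ * w m
    telescope zero    = +-identityˡ (5ℚ * w m)
    telescope (suc n) = trans
      (solve 2 (λ s x → s :+ x :+ con 5ℚ :* (con (+ 4 / 5) :* x) := s :+ con 5ℚ :* x)
        refl (∑ n (λ j → w (j ℕ.+ m))) (w (n ℕ.+ m)))
      (telescope n)

  -- If the weights have two upper bounds, one without an error term and one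
  -- decaying geometrically up to an error e * t j, then the first one can be used
  -- for the last m digits and the second one for all others.
  digit-sum-bound : ∀ (c : ℕ → ℚ) (g : ℕ → ℕ) h M e →
    0ℚ ≤ h → 0ℚ ≤ M → 0ℚ ≤ e →
    (∀ j → c j ≤ h * ι (g j)) → (∀ j → c j ≤ M * w j + e * t j) →
    ∀ m E → ⟦ E ⟧ c ≤ h * ι (∑⁺ m g) + M * (5ℚ * w m) + e * ι [ E ]ₜ
  digit-sum-bound c g h M e 0≤h 0≤M 0≤e c≤hg c≤Mw m E = begin
    ⟦ E ⟧ c
      ≡⟨ solve 2 (λ a b → a := (a :- b) :+ b) refl (⟦ E ⟧ c) (e * ⟦ E ⟧ t) ⟩
    ⟦ E ⟧ c - e * ⟦ E ⟧ t + e * ⟦ E ⟧ t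
      ≡⟨ cong₂ _+_ (sym (⟦⟧-linear E c e t)) (cong (e *_) (sym (value E))) ⟩
    ⟦ E ⟧ x + e * ι [ E ]ₜ
      ≤⟨ +-monoˡ-≤ (e * ι [ E ]ₜ) (begin
           ⟦ E ⟧ x                          ≤⟨ ⟦⟧≤∑ E x ⟩
           ∑ ℓ v                            ≤⟨ ≤-by refl (∑-nonneg m (λ j → v≥0 (j ℕ.+ ℓ))) ⟩
           ∑ ℓ v + ∑ m (λ j → v (j ℕ.+ ℓ))  ≡⟨ ∑-split ℓ m v ⟨
           ∑ (m ℕ.+ ℓ) v                    ≡⟨ cong (λ i → ∑ i v) (ℕ.+-comm m ℓ) ⟩
           ∑ (ℓ ℕ.+ m) v                    ≡⟨ ∑-split m ℓ v ⟩
           ∑ m v + ∑ ℓ (λ j → v (j ℕ.+ m))  ≤⟨ +-mono-≤ head tail ⟩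
           h * ι (∑⁺ m g) + M * (5ℚ * w m)  ∎) ⟩
    h * ι (∑⁺ m g) + M * (5ℚ * w m) + e * ι [ E ]ₜ ∎
    where
    open ≤-Reasoning
    ℓ = length E
    -- The error is split off beforehand: over the ones of E it sums to e * [ E ]ₜ.
    -- Extending the sum of v to ℓ + m terms lets it be cut at m even if ℓ < m.
    x v : ℕ → ℚ
    x j = c j - e * t j
    v j = x j ⊔ 0ℚ
    v≥0 : ∀ j → 0ℚ ≤ v j
    v≥0 j = p≤q⊔p (x j) 0ℚ
    x≤c : ∀ j → x j ≤ c j
    x≤c j = ≤-by {x j} (solve 2 (λ a b → a := (a :- b) :+ b) refl (c j) (e * t j))
      (*-nonneg 0≤e (ι≥0 (T j)))
    head : ∑ m v ≤ h * ι (∑⁺ m g)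
    head = ≤-trans
      (∑-mono-≤ m (λ j → ⊔-lub
        (≤-trans (x≤c j) (c≤hg j))
        (*-nonneg 0≤h (ι≥0 (g j)))))
      (≤-reflexive (∑-ι m h g))
    v≤Mw : ∀ j → v j ≤ M * w j
    v≤Mw j = ⊔-lub
      (≤-trans (+-monoˡ-≤ (- (e * t j)) (c≤Mw j))
        (≤-reflexive (solve 2 (λ a b → (a :+ b) :- b := a) refl (M * w j) (e * t j))))
      (*-nonneg 0≤M (w≥0 j))
    ∑-* : ∀ n f → ∑ n (λ j → M * f j) ≡ M * ∑ n f
    ∑-* zero    f = sym (*-zeroʳ M)
    ∑-* (suc n) f = trans (cong (_+ (M * f n)) (∑-* n f)) (sym (*-distribˡ-+ M _ _))
    tail : ∑ ℓ (λ j → v (j ℕ.+ m)) ≤ M * (5ℚ * w m)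
    tail = begin
      ∑ ℓ (λ j → v (j ℕ.+ m))        ≤⟨ ∑-mono-≤ ℓ (λ j → v≤Mw (j ℕ.+ m)) ⟩
      ∑ ℓ (λ j → M * w (j ℕ.+ m))    ≡⟨ ∑-* ℓ (λ j → w (j ℕ.+ m)) ⟩
      M * ∑ ℓ (λ j → w (j ℕ.+ m))    ≤⟨ *-monoʳ 0≤M (∑w≤ m ℓ) ⟩
      M * (5ℚ * w m)                 ∎

  -- Decay of the deviations of single Tribonacci numbers

  -- It vanishes exactly at the root to be approximated.
  residual : ℚ → ℚ
  residual q = q ^ 3 - (q ^ 2 + q + 1ℚ)

  -- The deviation for k = 1 of the string consisting of a one followed by j zeros.
  d : ℚ → ℕ → ℚ
  d q j = t (suc j) - q * t j

  t-rec : ∀ j → t (3 ℕ.+ j) ≡ t (2 ℕ.+ j) + t (1 ℕ.+ j) + t j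
  t-rec j = trans (ι-+ (T (2 ℕ.+ j) ℕ.+ T (1 ℕ.+ j)) (T j))
    (cong (_+ t j) (ι-+ (T (2 ℕ.+ j)) (T (1 ℕ.+ j))))

  t≥0 : ∀ j → 0ℚ ≤ t j
  t≥0 j = ι≥0 (T j)

  2ℚ : ℚ
  2ℚ = + 2 / 1

  -- Modulo residual q the polynomial x ^ 3 - x ^ 2 - x - 1 is divisible by x - q.
  -- The quotient annihilates d up to the residual, and the relation below is the
  -- reduction of x ^ 4 by the quotient.
  d-rec : ∀ q j → d q (4 ℕ.+ j) ≡
    (+ 4 / 1 - 2ℚ * q) * d q (1 ℕ.+ j)
    + ((+ 3 / 1 + 2ℚ * q - 2ℚ * q * q) * d q j + - 2ℚ * (residual q * t j))
  d-rec q j = identity (t j) (t (1 ℕ.+ j)) (t (2 ℕ.+ j))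
    (t-rec j) (t-rec (1 ℕ.+ j)) (t-rec (2 ℕ.+ j))
    where
    identity : ∀ x y z {t₃ t₄ t₅} → t₃ ≡ z + y + x → t₄ ≡ t₃ + z + y → t₅ ≡ t₄ + t₃ + z →
      t₅ - q * t₄ ≡
        (+ 4 / 1 - 2ℚ * q) * (z - q * y)
        + ((+ 3 / 1 + 2ℚ * q - 2ℚ * q * q) * (y - q * x) + - 2ℚ * (residual q * x))
    identity x y z refl refl refl = solve 4 (λ q x y z →
      let t₃ = z :+ y :+ x
          t₄ = t₃ :+ z :+ y
          rq = q :* (q :* (q :* con 1ℚ)) :- (q :* (q :* con 1ℚ) :+ q :+ con 1ℚ)
      in (t₄ :+ t₃ :+ z) :- q :* t₄ :=
         (con (+ 4 / 1) :- con 2ℚ :* q) :* (z :- q :* y)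
         :+ ((con (+ 3 / 1) :+ con 2ℚ :* q :- con 2ℚ :* q :* q) :* (y :- q :* x)
             :+ con (- 2ℚ) :* (rq :* x)))
      refl q x y z

  module _ {q : ℚ} (1·83≤q : + 183 / 100 ≤ q) (q≤1·84 : q ≤ + 184 / 100) where

    private
      -- The slacks below are polynomials in u and v with nonnegative coefficients.
      u v : ℚ
      u = q - + 183 / 100
      v = + 184 / 100 - q
      0≤u : 0ℚ ≤ u
      0≤u = p≤q⇒0≤q-p 1·83≤q
      0≤v : 0ℚ ≤ v
      0≤v = p≤q⇒0≤q-p q≤1·84

    coeff₁ : ∣ + 4 / 1 - 2ℚ * q ∣ ≤ + 7 / 20
    coeff₁ = ∣∣≤
      (≤-by {r = 2ℚ * u + + 1 / 100}
        (solve 1 (λ q → con (+ 7 / 20) := (con (+ 4 / 1) :- con 2ℚ :* q)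
           :+ (con 2ℚ :* (q :- con (+ 183 / 100)) :+ con (+ 1 / 100))) refl q)
        (+-nonneg (*-nonneg {2ℚ} (≤ᵇ⇒≤ tt) 0≤u) (≤ᵇ⇒≤ {0ℚ} {+ 1 / 100} tt)))
      (≤-by {r = 2ℚ * v + + 67 / 100}
        (solve 1 (λ q → con (+ 7 / 20) := :- (con (+ 4 / 1) :- con 2ℚ :* q)
           :+ (con 2ℚ :* (con (+ 184 / 100) :- q) :+ con (+ 67 / 100))) refl q)
        (+-nonneg (*-nonneg {2ℚ} (≤ᵇ⇒≤ tt) 0≤v) (≤ᵇ⇒≤ {0ℚ} {+ 67 / 100} tt)))

    coeff₀ : ∣ + 3 / 1 + 2ℚ * q - 2ℚ * q * q ∣ ≤ + 1 / 10
    coeff₀ = ∣∣≤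
      (≤-by {r = 2ℚ * (u * u) + + 532 / 100 * u + + 1378 / 10000}
        (solve 1 (λ q → let u = q :- con (+ 183 / 100) in
           con (+ 1 / 10) := (con (+ 3 / 1) :+ con 2ℚ :* q :- con 2ℚ :* q :* q)
           :+ (con 2ℚ :* (u :* u) :+ con (+ 532 / 100) :* u :+ con (+ 1378 / 10000))) refl q)
        (+-nonneg (+-nonneg
          (*-nonneg {2ℚ} (≤ᵇ⇒≤ tt) (*-nonneg 0≤u 0≤u))
          (*-nonneg {+ 532 / 100} (≤ᵇ⇒≤ tt) 0≤u)) (≤ᵇ⇒≤ {0ℚ} {+ 1378 / 10000} tt)))
      (≤-by {r = 2ℚ * (u * v) + + 534 / 100 * v + + 88 / 10000}
        (solve 1 (λ q → let u = q :- con (+ 183 / 100) ; v = con (+ 184 / 100) :- q in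
           con (+ 1 / 10) := :- (con (+ 3 / 1) :+ con 2ℚ :* q :- con 2ℚ :* q :* q)
           :+ (con 2ℚ :* (u :* v) :+ con (+ 534 / 100) :* v :+ con (+ 88 / 10000))) refl q)
        (+-nonneg (+-nonneg
          (*-nonneg {2ℚ} (≤ᵇ⇒≤ tt) (*-nonneg 0≤u 0≤v))
          (*-nonneg {+ 534 / 100} (≤ᵇ⇒≤ tt) 0≤v)) (≤ᵇ⇒≤ {0ℚ} {+ 88 / 10000} tt)))

    d-decay : ∀ j → ∣ d q j ∣ ≤ w j + ∣ residual q ∣ * t j
    d-decay j = go j
      where
      ρ = ∣ residual q ∣
      ρt≥0 : ∀ j → 0ℚ ≤ ρ * t j
      ρt≥0 j = *-nonneg (0≤∣p∣ (residual q)) (t≥0 j)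

      base : ∀ j → t (suc j) - + 183 / 100 * t j ≤ w j → + 184 / 100 * t j - t (suc j) ≤ w j →
             ∣ d q j ∣ ≤ w j + ρ * t j
      base j hi lo = ≤-trans
        (∣∣≤
          (≤-trans (≤-by {r = u * t j}
             (solve 3 (λ q x y → y :- con (+ 183 / 100) :* x
                := (y :- q :* x) :+ (q :- con (+ 183 / 100)) :* x) refl q (t j) (t (suc j)))
             (*-nonneg 0≤u (t≥0 j))) hi)
          (≤-trans (≤-by {r = v * t j}
             (solve 3 (λ q x y → con (+ 184 / 100) :* x :- y
                := :- (y :- q :* x) :+ (con (+ 184 / 100) :- q) :* x) refl q (t j) (t (suc j)))
             (*-nonneg 0≤v (t≥0 j))) lo))
        (≤-by {w j} refl (ρt≥0 j))

      -- The slack of w is (4/5) ^ 4 - (7/20 * 4/5 + 1/10) = 296/10000.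
      step : ∀ j →
        + 7 / 20 * (w (1 ℕ.+ j) + ρ * t (1 ℕ.+ j))
          + (+ 1 / 10 * (w j + ρ * t j) + 2ℚ * (ρ * t j))
        ≤ w (4 ℕ.+ j) + ρ * t (4 ℕ.+ j)
      step j = ≤-by
        (identity (w j) ρ (t j) (t (1 ℕ.+ j)) z t₂ (t-rec j) (t-rec (1 ℕ.+ j)))
        (+-nonneg (*-nonneg {+ 296 / 10000} (≤ᵇ⇒≤ tt) (w≥0 j))
          (*-nonneg (0≤∣p∣ (residual q))
            (+-nonneg (+-nonneg
              (*-nonneg {+ 73 / 20} (≤ᵇ⇒≤ tt) (t≥0 (1 ℕ.+ j)))
              (*-nonneg {+ 9 / 10} (≤ᵇ⇒≤ tt) (t≥0 j)))
              (*-nonneg {2ℚ} (≤ᵇ⇒≤ tt) (ι≥0 (tribonacci (2 ℕ.+ j)))))))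
        where
        z = ι (tribonacci (2 ℕ.+ j))
        t₂ : t (2 ℕ.+ j) ≡ t (1 ℕ.+ j) + t j + z
        t₂ = trans (ι-+ (T (1 ℕ.+ j) ℕ.+ T j) (tribonacci (2 ℕ.+ j)))
          (cong (_+ z) (ι-+ (T (1 ℕ.+ j)) (T j)))
        identity : ∀ w ρ x y z {t₂ t₃ t₄} →
          t₂ ≡ y + x + z → t₃ ≡ t₂ + y + x → t₄ ≡ t₃ + t₂ + y →
          + 4 / 5 * (+ 4 / 5 * (+ 4 / 5 * (+ 4 / 5 * w))) + ρ * t₄ ≡
          + 7 / 20 * (+ 4 / 5 * w + ρ * y) + (+ 1 / 10 * (w + ρ * x) + 2ℚ * (ρ * x))
          + (+ 296 / 10000 * w + ρ * (+ 73 / 20 * y + + 9 / 10 * x + 2ℚ * z))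
        identity w ρ x y z refl refl refl = solve 5 (λ w ρ x y z →
          let k = con (+ 4 / 5)
              t₂ = y :+ x :+ z
              t₃ = t₂ :+ y :+ x
          in k :* (k :* (k :* (k :* w))) :+ ρ :* (t₃ :+ t₂ :+ y) :=
             con (+ 7 / 20) :* (k :* w :+ ρ :* y)
             :+ (con (+ 1 / 10) :* (w :+ ρ :* x) :+ con 2ℚ :* (ρ :* x))
             :+ (con (+ 296 / 10000) :* w
                 :+ ρ :* (con (+ 73 / 20) :* y :+ con (+ 9 / 10) :* x :+ con 2ℚ :* z)))
          refl w ρ x y z

      ∣r*t∣ : ∀ j → ∣ residual q * t j ∣ ≤ ρ * t j
      ∣r*t∣ j = ∣∣*-mono {residual q} {ρ} {t j} {t j} ≤-refl (≤-reflexive (0≤p⇒∣p∣≡p (t≥0 j)))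

      go : ∀ j → ∣ d q j ∣ ≤ w j + ρ * t j
      go 0 = base 0 (≤ᵇ⇒≤ tt) (≤ᵇ⇒≤ tt)
      go 1 = base 1 (≤ᵇ⇒≤ tt) (≤ᵇ⇒≤ tt)
      go 2 = base 2 (≤ᵇ⇒≤ tt) (≤ᵇ⇒≤ tt)
      go 3 = base 3 (≤ᵇ⇒≤ tt) (≤ᵇ⇒≤ tt)
      go (suc (suc (suc (suc j)))) = ≤-trans (≤-reflexive (cong ∣_∣ (d-rec q j))) (≤-trans
        (∣∣+-mono (∣∣*-mono coeff₁ (go (suc j)))
          (∣∣+-mono (∣∣*-mono coeff₀ (go j))
            (∣∣*-mono { - 2ℚ} {2ℚ} (≤ᵇ⇒≤ tt) (∣r*t∣ j))))
        (step j))

  -- The deviation of the string consisting of a one followed by j zeros.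
  δ : ℕ → ℚ → ℕ → ℚ
  δ k q j = t (k ℕ.+ j) - q ^ k * t j

  δ-suc : ∀ k q j → δ (suc k) q j ≡ δ k q (suc j) + q ^ k * d q j
  δ-suc k q j = trans
    (solve 5 (λ a Q q x y → a :- q :* Q :* x := (a :- Q :* y) :+ Q :* (y :- q :* x))
      refl (t (suc k ℕ.+ j)) (q ^ k) q (t j) (t (suc j)))
    (cong (λ i → (t i - q ^ k * t (suc j)) + q ^ k * d q j) (sym (ℕ.+-suc k j)))

  module _ {q : ℚ} (1·83≤q : + 183 / 100 ≤ q) (q≤1·84 : q ≤ + 184 / 100) where

    private
      ρ = ∣ residual q ∣
      0≤q : 0ℚ ≤ q
      0≤q = ≤-trans (≤ᵇ⇒≤ {0ℚ} {+ 183 / 100} tt) 1·83≤q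

    -- Induction on k by δ-suc, with q ≤ 2 and t (suc j) ≤ 2 * t j.
    δ-decay : ∀ k j → ∣ δ k q j ∣ ≤ 2ℚ ^ k * (w j + ι k * (ρ * t j))
    δ-decay zero j = subst₂ _≤_
      (cong ∣_∣ (solve 1 (λ x → con 0ℚ := x :- con 1ℚ :* x) refl (t j)))
      (solve 2 (λ w x → w := con 1ℚ :* (w :+ con 0ℚ :* x)) refl (w j) (ρ * t j))
      (w≥0 j)
    δ-decay (suc k) j = begin
      ∣ δ (suc k) q j ∣
        ≡⟨ cong ∣_∣ (δ-suc k q j) ⟩
      ∣ δ k q (suc j) + q ^ k * d q j ∣
        ≤⟨ ∣∣+-mono (δ-decay k (suc j))
             (∣∣*-mono ∣q^k∣≤2^k (d-decay 1·83≤q q≤1·84 j)) ⟩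
      2ℚ ^ k * (w (suc j) + ι k * (ρ * t (suc j))) + 2ℚ ^ k * (w j + ρ * t j)
        ≤⟨ ≤-by
             (solve 6 (λ P w κ ρ x y →
                con 2ℚ :* P :* (w :+ (con 1ℚ :+ κ) :* (ρ :* x)) :=
                P :* (con (+ 4 / 5) :* w :+ κ :* (ρ :* y)) :+ P :* (w :+ ρ :* x)
                :+ P :* (con (+ 1 / 5) :* w :+ κ :* (ρ :* (x :+ x :- y)) :+ ρ :* x))
               refl (2ℚ ^ k) (w j) (ι k) ρ (t j) (t (suc j)))
             (*-nonneg 0≤2^k (+-nonneg (+-nonneg
               (*-nonneg {+ 1 / 5} (≤ᵇ⇒≤ tt) (w≥0 j))
               (*-nonneg (ι≥0 k) (*-nonneg (0≤∣p∣ (residual q)) (p≤q⇒0≤q-p t-suc≤))))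
               (*-nonneg (0≤∣p∣ (residual q)) (t≥0 j)))) ⟩
      2ℚ * 2ℚ ^ k * (w j + (1ℚ + ι k) * (ρ * t j))
        ≡⟨ cong (λ κ → 2ℚ ^ suc k * (w j + κ * (ρ * t j))) (ι-+ 1 k) ⟨
      2ℚ ^ suc k * (w j + ι (suc k) * (ρ * t j)) ∎
      where
      open ≤-Reasoning
      0≤2^k : 0ℚ ≤ 2ℚ ^ k
      0≤2^k = ^-nonneg {2ℚ} (≤ᵇ⇒≤ tt) k
      ∣q^k∣≤2^k : ∣ q ^ k ∣ ≤ 2ℚ ^ k
      ∣q^k∣≤2^k = subst (_≤ 2ℚ ^ k) (sym (0≤p⇒∣p∣≡p (^-nonneg 0≤q k)))
        (^-mono-≤ 0≤q (≤-trans q≤1·84 (≤ᵇ⇒≤ {+ 184 / 100} {2ℚ} tt)) k)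
      t-suc≤ : t (suc j) ≤ t j + t j
      t-suc≤ = subst (t (suc j) ≤_) (ι-+ (T j) (T j)) (ι-mono-≤ (T-suc≤2*T j))

  -- Enclosure of the root

  -- A / S and B / S enclose the root 1.83928675521416113...
  S A B : ℕ
  S = 10000000000000000
  A = 18392867552141611
  B = 18392867552141612

  h a b : ℚ
  h = + 1 / S
  a = ι A * h
  b = ι B * h

  square-nonneg : ∀ p → 0ℚ ≤ p * p
  square-nonneg p with ≤-total 0ℚ p
  ... | inj₁ 0≤p = *-nonneg 0≤p 0≤p
  ... | inj₂ p≤0 = subst (0ℚ ≤_) (solve 1 (λ p → :- p :* :- p := p :* p) refl p)
    (*-nonneg (neg-antimono-≤ p≤0) (neg-antimono-≤ p≤0))

  -- The difference quotient of the residual is p p + p q + q q - p - q - 1, and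
  -- four times it equals (2 p + q - 1) ^ 2 + (3 q - 5) * (q + 1).
  residual-mono : ∀ {p q} → + 5 / 3 ≤ q → p ≤ q → residual p ≤ residual q
  residual-mono {p} {q} 5/3≤q p≤q = ≤-by
    (solve 2 (λ p q →
      let s = con 2ℚ :* p :+ q :- con 1ℚ
          r = λ q → q :* (q :* (q :* con 1ℚ)) :- (q :* (q :* con 1ℚ) :+ q :+ con 1ℚ)
      in r q := r p :+ con (+ 1 / 4) :* ((q :- p) :*
           (s :* s :+ con (+ 3 / 1) :* (q :- con (+ 5 / 3)) :* (q :+ con 1ℚ))))
      refl p q)
    (*-nonneg {+ 1 / 4} (≤ᵇ⇒≤ tt) (*-nonneg (p≤q⇒0≤q-p p≤q)
      (+-nonneg (square-nonneg (2ℚ * p + q - 1ℚ))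
        (*-nonneg (*-nonneg {+ 3 / 1} (≤ᵇ⇒≤ tt) (p≤q⇒0≤q-p 5/3≤q))
          (+-nonneg (≤-trans (≤ᵇ⇒≤ {0ℚ} {+ 5 / 3} tt) 5/3≤q) (≤ᵇ⇒≤ {0ℚ} {1ℚ} tt))))))

  -- The residual is below - h at a and above h at b.
  enclosure : ∀ {q} → ∣ residual q ∣ ≤ h → a ≤ q × q ≤ b
  enclosure {q} ∣r∣≤h = ≮⇒≥ q≮a , ≮⇒≥ b≮q
    where
    q≮a : q ≮ a
    q≮a q<a = <-irrefl refl (begin-strict
      h            <⟨ toWitness {a? = h <? - residual a} tt ⟩
      - residual a        ≤⟨ neg-antimono-≤ (residual-mono (≤ᵇ⇒≤ tt) (<⇒≤ q<a)) ⟩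
      - residual q        ≤⟨ p≤∣p∣ (- residual q) ⟩
      ∣ - residual q ∣    ≡⟨ ∣-p∣≡∣p∣ (residual q) ⟩
      ∣ residual q ∣      ≤⟨ ∣r∣≤h ⟩
      h            ∎)
      where open ≤-Reasoning
    b≮q : b ≮ q
    b≮q b<q = <-irrefl refl (begin-strict
      h            <⟨ toWitness {a? = h <? residual b} tt ⟩
      residual b   ≤⟨ residual-mono (≤-trans (≤ᵇ⇒≤ {+ 5 / 3} {b} tt) (<⇒≤ b<q)) (<⇒≤ b<q) ⟩
      residual q          ≤⟨ p≤∣p∣ (residual q) ⟩
      ∣ residual q ∣      ≤⟨ ∣r∣≤h ⟩
      h            ∎)
      where open ≤-Reasoning

  -- The last digits, computed explicitly

  -- The Tribonacci numbers computed in linear time: n steps from three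
  -- consecutive numbers x, y, z.
  T-window : ℕ → ℕ → ℕ → ℕ → ℕ
  T-window zero    x y z = x
  T-window (suc n) x y z = T-window n y z (z ℕ.+ y ℕ.+ x)

  T-iter : ℕ → ℕ
  T-iter n = T-window n 1 2 4

  T≡T-iter : ∀ n → T n ≡ T-iter n
  T≡T-iter n = trans (cong T (sym (ℕ.+-identityʳ n))) (sym (window n 0))
    where
    window : ∀ n i → T-window n (T i) (T (1 ℕ.+ i)) (T (2 ℕ.+ i)) ≡ T (n ℕ.+ i)
    window zero    i = refl
    window (suc n) i = trans (window n (suc i)) (cong T (ℕ.+-suc n i))

  -- S ^ k times the positive parts of T (k + j) - a ^ k * T j and of
  -- b ^ k * T j - T (k + j).
  excess deficit : ℕ → ℕ → ℕ
  excess k j = T-iter (k ℕ.+ j) ℕ.* S ℕ.^ k ℕ.∸ A ℕ.^ k ℕ.* T-iter j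
  deficit k j = B ℕ.^ k ℕ.* T-iter j ℕ.∸ T-iter (k ℕ.+ j) ℕ.* S ℕ.^ k

  scaled-power : ∀ m k → (ι m * h) ^ k ≡ h ^ k * ι (m ℕ.^ k)
  scaled-power m k = begin
    (ι m * h) ^ k          ≡⟨ ^-distrib-* (ι m) h k ⟩
    ι m ^ k * h ^ k        ≡⟨ *-comm (ι m ^ k) (h ^ k) ⟩
    h ^ k * ι m ^ k        ≡⟨ cong (h ^ k *_) (ι-^ m k) ⟨
    h ^ k * ι (m ℕ.^ k)    ∎
    where open ≡-Reasoning

  h^k*S^k≡1 : ∀ k → h ^ k * ι (S ℕ.^ k) ≡ 1ℚ
  h^k*S^k≡1 k = trans (sym (scaled-power S k)) (1^k≡1 k)

  0≤h^k : ∀ k → 0ℚ ≤ h ^ k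
  0≤h^k k = ^-nonneg {h} (≤ᵇ⇒≤ tt) k

  -- Applied to m = A and m = B, where ι m * h is a and b.
  scaled-diff : ∀ k m i j →
    h ^ k * (ι (T i ℕ.* S ℕ.^ k) - ι (m ℕ.^ k ℕ.* T j)) ≡ t i - (ι m * h) ^ k * t j
  scaled-diff k m i j = begin
    h ^ k * (ι (T i ℕ.* S ℕ.^ k) - ι (m ℕ.^ k ℕ.* T j))
      ≡⟨ cong₂ (λ x y → h ^ k * (x - y)) (ι-* (T i) (S ℕ.^ k)) (ι-* (m ℕ.^ k) (T j)) ⟩
    h ^ k * (t i * ι (S ℕ.^ k) - ι (m ℕ.^ k) * t j)
      ≡⟨ solve 5 (λ H P μ x y → H :* (x :* P :- μ :* y) := (H :* P) :* x :- (H :* μ) :* y)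
           refl (h ^ k) (ι (S ℕ.^ k)) (ι (m ℕ.^ k)) (t i) (t j) ⟩
    (h ^ k * ι (S ℕ.^ k)) * t i - (h ^ k * ι (m ℕ.^ k)) * t j
      ≡⟨ cong₂ (λ x y → x * t i - y * t j) (h^k*S^k≡1 k) (sym (scaled-power m k)) ⟩
    1ℚ * t i - (ι m * h) ^ k * t j
      ≡⟨ cong (_- (ι m * h) ^ k * t j) (*-identityˡ (t i)) ⟩
    t i - (ι m * h) ^ k * t j ∎
    where open ≡-Reasoning

  δ≤excess : ∀ {q} → a ≤ q → ∀ k j → δ k q j ≤ h ^ k * ι (excess k j)
  δ≤excess {q} a≤q k j = begin
    t (k ℕ.+ j) - q ^ k * t j
      ≤⟨ +-monoʳ-≤ (t (k ℕ.+ j)) (neg-antimono-≤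
           (*-monoˡ (t≥0 j) (^-mono-≤ (≤ᵇ⇒≤ {0ℚ} {a} tt) a≤q k))) ⟩
    t (k ℕ.+ j) - a ^ k * t j
      ≡⟨ scaled-diff k A (k ℕ.+ j) j ⟨
    h ^ k * (ι (T (k ℕ.+ j) ℕ.* S ℕ.^ k) - ι (A ℕ.^ k ℕ.* T j))
      ≤⟨ *-monoʳ (0≤h^k k) (ι-∸ (T (k ℕ.+ j) ℕ.* S ℕ.^ k) (A ℕ.^ k ℕ.* T j)) ⟩
    h ^ k * ι (T (k ℕ.+ j) ℕ.* S ℕ.^ k ℕ.∸ A ℕ.^ k ℕ.* T j)
      ≡⟨ cong₂ (λ x y → h ^ k * ι (x ℕ.* S ℕ.^ k ℕ.∸ A ℕ.^ k ℕ.* y))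
           (T≡T-iter (k ℕ.+ j)) (T≡T-iter j) ⟩
    h ^ k * ι (excess k j) ∎
    where open ≤-Reasoning

  -δ≤deficit : ∀ {q} → 0ℚ ≤ q → q ≤ b → ∀ k j → - δ k q j ≤ h ^ k * ι (deficit k j)
  -δ≤deficit {q} 0≤q q≤b k j = begin
    - (t (k ℕ.+ j) - q ^ k * t j)
      ≤⟨ neg-antimono-≤ (+-monoʳ-≤ (t (k ℕ.+ j)) (neg-antimono-≤
           (*-monoˡ (t≥0 j) (^-mono-≤ 0≤q q≤b k)))) ⟩
    - (t (k ℕ.+ j) - b ^ k * t j)
      ≡⟨ cong -_ (scaled-diff k B (k ℕ.+ j) j) ⟨
    - (h ^ k * (ι (T (k ℕ.+ j) ℕ.* S ℕ.^ k) - ι (B ℕ.^ k ℕ.* T j)))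
      ≡⟨ solve 3 (λ H x y → :- (H :* (x :- y)) := H :* (y :- x)) refl
           (h ^ k) (ι (T (k ℕ.+ j) ℕ.* S ℕ.^ k)) (ι (B ℕ.^ k ℕ.* T j)) ⟩
    h ^ k * (ι (B ℕ.^ k ℕ.* T j) - ι (T (k ℕ.+ j) ℕ.* S ℕ.^ k))
      ≤⟨ *-monoʳ (0≤h^k k) (ι-∸ (B ℕ.^ k ℕ.* T j) (T (k ℕ.+ j) ℕ.* S ℕ.^ k)) ⟩
    h ^ k * ι (B ℕ.^ k ℕ.* T j ℕ.∸ T (k ℕ.+ j) ℕ.* S ℕ.^ k)
      ≡⟨ cong₂ (λ x y → h ^ k * ι (B ℕ.^ k ℕ.* y ℕ.∸ x ℕ.* S ℕ.^ k))
           (T≡T-iter (k ℕ.+ j)) (T≡T-iter j) ⟩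
    h ^ k * ι (deficit k j) ∎
    where open ≤-Reasoning

  -- The deviations of binary strings

  -- The quantity of the theorem, with q in place of ψ.
  deviation : ℕ → ℚ → List Bit → ℚ
  deviation k q E = ι [ E ++ replicate k 0b ]ₜ - q ^ k * ι [ E ]ₜ

  deviation-sum : ∀ k q E → deviation k q E ≡ ⟦ E ⟧ (δ k q)
  deviation-sum k q E = trans
    (cong₂ (λ x y → x - q ^ k * y) (value-shift k E) (value E))
    (sym (⟦⟧-linear E (λ j → t (k ℕ.+ j)) (q ^ k) t))

  -- The total error is at most this multiple of the absolute value of residual q.
  errorFactor : ℕ → List Bit → ℕ
  errorFactor k E = 2 ℕ.^ k ℕ.* (k ℕ.* [ E ]ₜ)

  -- The bound of digit-sum-bound for m = 40, without the error.  At this m the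
  -- second summand is below 1/300 for k ≤ 3, which is less than the margin left
  -- in the bounds of the theorem.
  bound : ℕ → (ℕ → ℕ) → ℚ
  bound k g = h ^ k * ι (∑⁺ 40 g) + 2ℚ ^ k * (5ℚ * w 40)

  -- The successor makes the hypothesis imply that the residual itself is at most h.
  deviation-bounds : ∀ k q E → ∣ residual q ∣ * ι (suc (errorFactor k E)) ≤ h →
    deviation k q E ≤ bound k (excess k) + h × - deviation k q E ≤ bound k (deficit k) + h
  deviation-bounds k q E small = upper , lower
    where
    open ≤-Reasoning
    ρ = ∣ residual q ∣
    X = errorFactor k E
    0≤ρ : 0ℚ ≤ ρ
    0≤ρ = 0≤∣p∣ (residual q)
    ρ≤h : ρ ≤ h
    ρ≤h = begin
      ρ               ≡⟨ *-identityʳ ρ ⟨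
      ρ * ι 1         ≤⟨ *-monoʳ 0≤ρ (ι-mono-≤ {1} {suc X} (ℕ.s≤s ℕ.z≤n)) ⟩
      ρ * ι (suc X)   ≤⟨ small ⟩
      h               ∎
    a≤q : a ≤ q
    a≤q = proj₁ (enclosure ρ≤h)
    q≤b : q ≤ b
    q≤b = proj₂ (enclosure ρ≤h)
    1·83≤q : + 183 / 100 ≤ q
    1·83≤q = ≤-trans (≤ᵇ⇒≤ {+ 183 / 100} {a} tt) a≤q
    q≤1·84 : q ≤ + 184 / 100
    q≤1·84 = ≤-trans q≤b (≤ᵇ⇒≤ {b} {+ 184 / 100} tt)
    0≤2^k : 0ℚ ≤ 2ℚ ^ k
    0≤2^k = ^-nonneg {2ℚ} (≤ᵇ⇒≤ tt) k
    e : ℚ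
    e = 2ℚ ^ k * (ι k * ρ)
    0≤e : 0ℚ ≤ e
    0≤e = *-nonneg 0≤2^k (*-nonneg (ι≥0 k) 0≤ρ)
    error≤h : e * ι [ E ]ₜ ≤ h
    error≤h = begin
      2ℚ ^ k * (ι k * ρ) * ι [ E ]ₜ
        ≡⟨ solve 4 (λ P κ ρ n → P :* (κ :* ρ) :* n := ρ :* (P :* (κ :* n)))
             refl (2ℚ ^ k) (ι k) ρ (ι [ E ]ₜ) ⟩
      ρ * (2ℚ ^ k * (ι k * ι [ E ]ₜ))
        ≡⟨ cong₂ (λ x y → ρ * (x * y)) (ι-^ 2 k) (ι-* k [ E ]ₜ) ⟨
      ρ * (ι (2 ℕ.^ k) * ι (k ℕ.* [ E ]ₜ))
        ≡⟨ cong (ρ *_) (ι-* (2 ℕ.^ k) (k ℕ.* [ E ]ₜ)) ⟨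
      ρ * ι X        ≤⟨ *-monoʳ 0≤ρ (ι-mono-≤ (ℕ.n≤1+n X)) ⟩
      ρ * ι (suc X)  ≤⟨ small ⟩
      h              ∎
    tail-bound : ∀ {c} j → c ≤ ∣ δ k q j ∣ → c ≤ 2ℚ ^ k * w j + e * t j
    tail-bound j c≤ = ≤-trans c≤ (≤-trans (δ-decay 1·83≤q q≤1·84 k j)
      (≤-reflexive (solve 5 (λ P w κ ρ x →
        P :* (w :+ κ :* (ρ :* x)) := P :* w :+ P :* (κ :* ρ) :* x)
        refl (2ℚ ^ k) (w j) (ι k) ρ (t j))))
    upper : deviation k q E ≤ bound k (excess k) + h
    upper = begin
      deviation k q E
        ≡⟨ deviation-sum k q E ⟩
      ⟦ E ⟧ (δ k q)
        ≤⟨ digit-sum-bound (δ k q) (excess k) (h ^ k) (2ℚ ^ k) e (0≤h^k k) 0≤2^k 0≤e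
             (δ≤excess a≤q k) (λ j → tail-bound j (p≤∣p∣ (δ k q j))) 40 E ⟩
      bound k (excess k) + e * ι [ E ]ₜ
        ≤⟨ +-monoʳ-≤ (bound k (excess k)) error≤h ⟩
      bound k (excess k) + h ∎
    lower : - deviation k q E ≤ bound k (deficit k) + h
    lower = begin
      - deviation k q E
        ≡⟨ cong -_ (deviation-sum k q E) ⟩
      - ⟦ E ⟧ (δ k q)
        ≡⟨ ⟦⟧-neg E (δ k q) ⟨
      ⟦ E ⟧ (λ j → - δ k q j)
        ≤⟨ digit-sum-bound (λ j → - δ k q j) (deficit k) (h ^ k) (2ℚ ^ k) e (0≤h^k k) 0≤2^k 0≤e
             (-δ≤deficit (≤-trans (≤ᵇ⇒≤ {0ℚ} {a} tt) a≤q) q≤b k)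
             (λ j → tail-bound j (subst (- δ k q j ≤_) (∣-p∣≡∣p∣ (δ k q j)) (p≤∣p∣ (- δ k q j)))) 40 E ⟩
      bound k (deficit k) + e * ι [ E ]ₜ
        ≤⟨ +-monoʳ-≤ (bound k (deficit k)) error≤h ⟩
      bound k (deficit k) + h ∎

  -- Numerical verification; one h is for the error, the other for the strict
  -- inequality of reals, which asks for a uniform gap.
  lower₁ : bound 1 (deficit 1) + h + h < + 596 / 1000
  lower₁ = toWitness {a? = _ <? _} tt

  upper₁ : bound 1 (excess 1) + h + h < + 856 / 1000
  upper₁ = toWitness {a? = _ <? _} tt

  lower₂ : bound 2 (deficit 2) + h + h < + 883 / 1000
  lower₂ = toWitness {a? = _ <? _} tt

  upper₂ : bound 2 (excess 2) + h + h < + 1460 / 1000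
  upper₂ = toWitness {a? = _ <? _} tt

  lower₃ : bound 3 (deficit 3) + h + h < + 1461 / 1000
  lower₃ = toWitness {a? = _ <? _} tt

  upper₃ : bound 3 (excess 3) + h + h < + 2298 / 1000
  upper₃ = toWitness {a? = _ <? _} tt

  deviation-between : ∀ k {l u} →
    bound k (deficit k) + h + h < l → bound k (excess k) + h + h < u →
    ∀ q n → ∣ residual q ∣ * ι (suc (errorFactor k ⟨ n ⟩ₜ)) ≤ h →
    let D = ι [ ⟨ n ⟩ₜ ++ replicate k 0b ]ₜ - q ^ k * ι n
    in - l + h < D × D + h < u
  deviation-between k {l} {u} <l <u q n small = subst
    (λ m → let D = ι [ ⟨ n ⟩ₜ ++ replicate k 0b ]ₜ - q ^ k * ι m in - l + h < D × D + h < u)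
    (value-⟨ n ⟩)
    (below , ≤-<-trans (+-monoˡ-≤ h (proj₂ ≤both)) <u)
    where
    D = deviation k q ⟨ n ⟩ₜ
    L = bound k (deficit k)
    ≤both : - D ≤ L + h × D ≤ bound k (excess k) + h
    ≤both = let up , lo = deviation-bounds k q ⟨ n ⟩ₜ small in lo , up
    cancel : ∀ p q → - (p + q + q) + q ≡ - (p + q)
    cancel = solve 2 (λ p q → :- (p :+ q :+ q) :+ q := :- (p :+ q)) refl
    neg-neg : ∀ p → - - p ≡ p
    neg-neg = solve 1 (λ p → :- (:- p) := p) refl
    below : - l + h < D
    below = begin-strict
      - l + h            <⟨ +-monoˡ-< h (neg-antimono-< <l) ⟩
      - (L + h + h) + h  ≡⟨ cancel L h ⟩
      - (L + h)          ≤⟨ neg-antimono-≤ (proj₁ ≤both) ⟩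
      - - D              ≡⟨ neg-neg D ⟩
      D                  ∎
      where open ≤-Reasoning

  -- A threshold for the residual that makes the error small.
  small-residual : ∀ X → ∃ λ ε → 0ℚ < ε × (∀ {p} → p < ε → p * ι (suc X) ≤ h)
  small-residual X = h * c , 0<hc , λ {p} p<hc → begin
    p * ι (suc X)        ≤⟨ *-monoˡ (ι≥0 (suc X)) (<⇒≤ p<hc) ⟩
    h * c * ι (suc X)    ≡⟨ *-assoc h c (ι (suc X)) ⟩
    h * (c * ι (suc X))  ≡⟨ cong (h *_) (*-inverseˡ (ι (suc X))) ⟩
    h * 1ℚ               ≡⟨ *-identityʳ h ⟩
    h                    ∎
    where
    open ≤-Reasoning
    instance
      ι>0 : Positive (ι (suc X))
      ι>0 = normalize-pos (suc X) 1
      ι≢0 : NonZero (ι (suc X))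
      ι≢0 = pos⇒nonZero (ι (suc X))
    c = 1/ ι (suc X)
    0<hc : 0ℚ < h * c
    0<hc = positive⁻¹ (h * c) {{pos*pos⇒pos h c {{1/pos⇒pos (ι (suc X))}}}}

-- Passage to the reals

open import Defs
import Data.Rational.Base as ℚ
import Data.Rational.Properties as ℚ
open import Relation.Nullary.Decidable using (toWitness)
open Rational using (h; bound; excess; deficit)

module _ (ψ : ℝ) (ψ-root : ψ ^ 3 ≃ ψ ^ 2 + ψ + 1ℝ) where

  -- The power of ψ is a separate argument φ, so that ψ itself can serve as the
  -- first power.
  deviation-between-reals : ∀ k {l u} →
    bound k (deficit k) ℚ.+ h ℚ.+ h ℚ.< l → bound k (excess k) ℚ.+ h ℚ.+ h ℚ.< u →
    ∀ φ → (∀ m → seq φ m ≡ seq ψ m Rational.^ k) → ∀ n →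
    let D = fromℕ [ ⟨ n ⟩ₜ ++ replicate k 0b ]ₜ - φ * fromℕ n
    in - fromℚ l < D × D < fromℚ u
  deviation-between-reals k {l} {u} <l <u φ φ≡ψ^k n =
    let ε , 0<ε , small = Rational.small-residual (Rational.errorFactor k ⟨ n ⟩ₜ)
        N , close       = ψ-root ε 0<ε
        between m N≤m   = subst
          (λ x → let D = Rational.ι [ ⟨ n ⟩ₜ ++ replicate k 0b ]ₜ ℚ.- x ℚ.* Rational.ι n
                 in ℚ.- l ℚ.+ h ℚ.< D × D ℚ.+ h ℚ.< u)
          (sym (φ≡ψ^k m))
          (Rational.deviation-between k <l <u (seq ψ m) n (small (close m N≤m)))
    in (h , N , 0<h , λ m N≤m → proj₁ (between m N≤m))
     , (h , N , 0<h , λ m N≤m → proj₂ (between m N≤m))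
    where
    0<h : 0ℚ ℚ.< h
    0<h = toWitness {a? = 0ℚ ℚ.<? h} tt

theorem15 :
    (ψ : ℝ) → ψ ^ 3 ≃ ψ ^ 2 + ψ + 1ℝ →
    (n : ℕ) →
    let D₁ = fromℕ [ ⟨ n ⟩ₜ ++ 0b ∷ [] ]ₜ - ψ * fromℕ n
        D₂ = fromℕ [ ⟨ n ⟩ₜ ++ 0b ∷ 0b ∷ [] ]ₜ - ψ ^ 2 * fromℕ n
        D₃ = fromℕ [ ⟨ n ⟩ₜ ++ 0b ∷ 0b ∷ 0b ∷ [] ]ₜ - ψ ^ 3 * fromℕ n
    in (- fromℚ (+ 596 / 1000) < D₁ × D₁ < fromℚ (+ 856 / 1000))
     × (- fromℚ (+ 883 / 1000) < D₂ × D₂ < fromℚ (+ 1460 / 1000))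
     × (- fromℚ (+ 1461 / 1000) < D₃ × D₃ < fromℚ (+ 2298 / 1000))
theorem15 ψ ψ-root n =
    deviation-between-reals ψ ψ-root 1 Rational.lower₁ Rational.upper₁ ψ
      (λ m → sym (ℚ.*-identityʳ (seq ψ m))) n
  , deviation-between-reals ψ ψ-root 2 Rational.lower₂ Rational.upper₂ (ψ ^ 2) (λ _ → refl) n
  , deviation-between-reals ψ ψ-root 3 Rational.lower₃ Rational.upper₃ (ψ ^ 3) (λ _ → refl) n
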